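{- Let $b$ be a positive odd integer and let $q$ be an odd prime. If $q > 2\sqrt{2b}$, then there are no positive integers $k, y$ such that $$(2^{k}-1)(b^{k}-1)=y^{q}.$$ -}

module Defs where

open import Data.Nat.Base using (ℕ; _*_; _<_)

infix 4 _·√_<_

-- Comparison of the real number c·√m with a natural number n.  Both sides
-- are nonnegative, so c·√m < n holds exactly when the squares compare.
_·√_<_ : ℕ → ℕ → ℕ → Set
c ·√ m < n = c * c * m < n * n

{-# OPTIONS --safe #-}

-- Every n ≤ q divides k; then q ∣ k, say k = q t, and with u = 2 ^ t, v = b ^ t
-- the number (u ^ q - 1)(v ^ q - 1) lies strictly between (u v - 1) ^ q and (u v) ^ q.
--
-- By strong induction on n it is enough to treat n = p ^ e.  Let p = 2 h + 1; as all
-- numbers below p divide k, lifting the exponent gives x ^ k - 1 ∣ c k u with p ∤ u and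
-- c ≤ x ^ h + 1, for x = 2 and x = b.  Since p ∣ y, p ^ q divides c₁ c₂ k², and
-- c₁ c₂ < q ^ (p - 1) by q² > 8 b.  Were p ^ e ∤ k, the p-part of k would be at most
-- q / p, and p ^ q would be too large.  The prime 2 is similar, with b ^ 2 in place of b.
module Submission where

open import Defs
open import Data.Nat.Base using (ℕ; _*_; _∸_; _^_; _<_; parity)
open import Data.Nat.Primality using (Prime)
open import Data.Parity.Base using (1ℙ)
open import Data.Product.Base using (_×_; ∃₂)
open import Relation.Binary.PropositionalEquality.Core using (_≡_)
open import Relation.Nullary.Negation.Core using (¬_)

open import Data.Fin.Base using (Fin; toℕ; fromℕ<)
open import Data.Fin.Properties using (pigeonhole; toℕ-fromℕ<; toℕ<n)
open import Data.List.Base using ([]; _∷_)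
open import Data.List.Relation.Unary.All using (_∷_)
open import Data.Nat.Base using (zero; suc; 2+; _+_; _≤_; z≤n; s≤s; z<s; s≤s⁻¹; NonZero; >-nonZero; >-nonZero⁻¹; nonTrivial⇒n>1)
open import Data.Nat.Coprimality using (Coprime; coprime-divisor) renaming (sym to coprime-sym)
open import Data.Nat.DivMod using (_/_; _%_; m≡m%n+[m/n]*n; m%n<n)
open import Data.Nat.Divisibility
open import Data.Nat.Induction using (<-rec)
open import Data.Nat.ListAction using (product)
open import Data.Nat.Primality using (prime⇒nonZero; prime⇒nonTrivial; prime⇒irreducible; euclidsLemma; prime[2]; ¬prime[1])
open import Data.Nat.Primality.Factorisation using (factorise; module PrimeFactorisation)
open import Data.Nat.Properties
open import Data.Nat.Tactic.RingSolver using (solve-∀)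
open import Data.Parity.Base using (0ℙ)
open import Data.Product.Base using (_,_; ∃; proj₁; proj₂)
open import Data.Sum.Base using (_⊎_; inj₁; inj₂; [_,_]′)
open import Function.Base using (_∘_; id)
open import Relation.Binary.PropositionalEquality using (_≢_; refl; sym; trans; cong; cong₂; subst; subst₂; module ≡-Reasoning)
open import Relation.Nullary.Decidable using (yes; no)
open import Relation.Nullary.Negation.Core using (contradiction)

-- Prime divisors and the `p`-part of a number.

prime∤1 : ∀ {p} → Prime p → p ∤ 1
prime∤1 p-prime p∣1 = ¬prime[1] (subst Prime (∣1⇒≡1 p∣1) p-prime)

∤-* : ∀ {p} → Prime p → ∀ {m n} → p ∤ m → p ∤ n → p ∤ m * n
∤-* p-prime {m} {n} p∤m p∤n = [ p∤m , p∤n ]′ ∘ euclidsLemma m n p-prime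

prime∣^⇒∣ : ∀ {p} → Prime p → ∀ m n → p ∣ m ^ n → p ∣ m
prime∣^⇒∣ p-prime m zero    p∣1 = contradiction p∣1 (prime∤1 p-prime)
prime∣^⇒∣ p-prime m (suc n) p∣  =
  [ id , prime∣^⇒∣ p-prime m n ]′ (euclidsLemma m (m ^ n) p-prime p∣)

coprime-prime^ : ∀ {p} → Prime p → ∀ {m} → p ∤ m → ∀ e → Coprime m (p ^ e)
coprime-prime^ p-prime p∤m zero    (_   , d∣1) = ∣1⇒≡1 d∣1
coprime-prime^ {p} p-prime {m} p∤m (suc e) {d} (d∣m , d∣p*pᵉ) =
  coprime-prime^ p-prime p∤m e (d∣m , coprime-divisor d⊥p d∣p*pᵉ)
  where
  d⊥p : Coprime d p
  d⊥p (c∣d , c∣p) with prime⇒irreducible p-prime c∣p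
  ... | inj₁ c≡1  = c≡1
  ... | inj₂ refl = contradiction (∣-trans c∣d d∣m) p∤m

prime^∣-cancel : ∀ {p} → Prime p → ∀ e {m n} → p ∤ m → p ^ e ∣ m * n → p ^ e ∣ n
prime^∣-cancel p-prime e p∤m = coprime-divisor (coprime-sym (coprime-prime^ p-prime p∤m e))

p-part : ∀ {p} → Prime p → ∀ n → 0 < n → ∃₂ λ v m → n ≡ p ^ v * m × p ∤ m
p-part {p} p-prime = <-rec _ go
  where
  go : ∀ n → (∀ {m} → m < n → 0 < m → ∃₂ λ v o → m ≡ p ^ v * o × p ∤ o) →
       0 < n → ∃₂ λ v o → n ≡ p ^ v * o × p ∤ o
  go n@(suc _) rec n>0 with p ∣? n
  ... | no p∤n  = 0 , n , sym (*-identityˡ n) , p∤n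
  ... | yes p∣n
    with v , o , m≡ , p∤o ← rec (quotient-< p∣n) (>-nonZero⁻¹ _ {{quotient≢0 p∣n}})
    = suc v , o , trans (m∣n⇒n≡m*quotient p∣n)
        (trans (cong (p *_) m≡) (sym (*-assoc p (p ^ v) o))) , p∤o
    where instance _ = prime⇒nonTrivial p-prime

∃prime∣ : ∀ n → 1 < n → ∃ λ p → Prime p × p ∣ n
∃prime∣ n 1<n with factorise n {{>-nonZero (<-trans z<s 1<n)}}
... | record { factors = []     ; isFactorisation = refl } = contradiction 1<n λ { (s≤s ()) }
... | record { factors = p ∷ ps ; isFactorisation = refl ; factorsPrime = p-prime ∷ _ } =
  p , p-prime , m∣m*n (product ps)

-- Geometric sums and their `p`-parts.

-- The quotient (x^k - 1)/(x - 1), kept free of division and truncated subtraction.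
geom : ℕ → ℕ → ℕ
geom x zero    = 0
geom x (suc k) = 1 + x * geom x k

[1+a]^k≡1+a*geom : ∀ a k → suc a ^ k ≡ 1 + a * geom (suc a) k
[1+a]^k≡1+a*geom a zero    = cong suc (sym (*-zeroʳ a))
[1+a]^k≡1+a*geom a (suc k) = trans (cong (suc a *_) ([1+a]^k≡1+a*geom a k)) (eq a (geom (suc a) k))
  where
  eq : ∀ a g → (1 + a) * (1 + a * g) ≡ 1 + a * (1 + (1 + a) * g)
  eq = solve-∀

geom-+ : ∀ x m n → geom x (m + n) ≡ geom x m + x ^ m * geom x n
geom-+ x zero    n = sym (*-identityˡ _)
geom-+ x (suc m) n = trans (cong (λ g → 1 + x * g) (geom-+ x m n)) (eq x (geom x m) (x ^ m) (geom x n))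
  where
  eq : ∀ x g z g′ → 1 + x * (g + z * g′) ≡ (1 + x * g) + x * z * g′
  eq = solve-∀

geom-* : ∀ x m n → geom x (m * n) ≡ geom x m * geom (x ^ m) n
geom-* x m zero    = trans (cong (geom x) (*-zeroʳ m)) (sym (*-zeroʳ (geom x m)))
geom-* x m (suc n) = begin
  geom x (m * suc n)                       ≡⟨ cong (geom x) (*-suc m n) ⟩
  geom x (m + m * n)                       ≡⟨ geom-+ x m (m * n) ⟩
  geom x m + x ^ m * geom x (m * n)        ≡⟨ cong (λ g → geom x m + x ^ m * g) (geom-* x m n) ⟩
  geom x m + x ^ m * (geom x m * geom (x ^ m) n) ≡⟨ eq (geom x m) (x ^ m) (geom (x ^ m) n) ⟩
  geom x m * (1 + x ^ m * geom (x ^ m) n)  ∎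
  where
  open ≡-Reasoning
  eq : ∀ g z g′ → g + z * (g * g′) ≡ g * (1 + z * g′)
  eq = solve-∀

-- The binomial coefficient C(n, 2).
triangle : ℕ → ℕ
triangle zero    = 0
triangle (suc n) = triangle n + n

triangle-odd : ∀ h → triangle (suc (h + h)) ≡ h * suc (h + h)
triangle-odd zero    = refl
triangle-odd (suc h) rewrite +-suc h h | triangle-odd h = eq h
  where
  eq : ∀ h → h * (1 + (h + h)) + (1 + (h + h)) + (2 + (h + h)) ≡ (1 + h) * (3 + (h + h))
  eq = solve-∀

-- Binomial expansion of ((1 + a)^n - 1)/a. The term linear in `a` is kept explicit because at
-- `n = p` it has to vanish modulo `p ^ 2`.
geom-expand : ∀ a n → ∃ λ r → geom (suc a) n ≡ n + a * triangle n + a * a * r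
geom-expand a zero    = 0 , eq a
  where
  eq : ∀ a → 0 ≡ a * 0 + a * a * 0
  eq = solve-∀
geom-expand a (suc n) with r , g≡ ← geom-expand a n =
  triangle n + r + a * r ,
  trans (cong (λ g → 1 + suc a * g) g≡) (eq a n (triangle n) r)
  where
  eq : ∀ a n t r → 1 + (1 + a) * (n + a * t + a * a * r)
                 ≡ 1 + n + a * (t + n) + a * a * (t + r + a * r)
  eq = solve-∀

∤-geom : ∀ {p} a n → p ∣ a → p ∤ n → p ∤ geom (suc a) n
∤-geom {p} a n p∣a p∤n p∣g with r , g≡ ← geom-expand a n = p∤n
  (∣m+n∣m⇒∣n (subst (p ∣_) (trans g≡ (eq a n (triangle n) r)) p∣g) (∣m⇒∣m*n _ p∣a))
  where
  eq : ∀ a n t r → n + a * t + a * a * r ≡ a * (t + a * r) + n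
  eq = solve-∀

-- Lifting the exponent; the modulus D is p for odd p and 4 for p = 2.
module _ {p D : ℕ} (p-prime : Prime p) (p∣D : p ∣ D)
  (geom-p : ∀ a → D ∣ a → ∃ λ w → geom (suc a) p ≡ p * w × p ∤ w) where

  private
    -- Each factor `p` of the exponent is peeled off by `geom-*`, which replaces the base `1 + a` by
    -- `(1 + a) ^ p = 1 + a * geom (suc a) p`. The new increment is still a multiple of `D`, so the
    -- induction on `v` continues.
    lift^ : ∀ v m a → p ∤ m → D ∣ a →
            ∃ λ u → p ∤ u × geom (suc a) (p ^ v * m) ∣ p ^ v * m * u
    lift^ zero m a p∤m D∣a = geom (suc a) (1 * m) ,
      ∤-geom a (1 * m) (∣-trans p∣D D∣a) (p∤m ∘ subst (p ∣_) (*-identityˡ m)) ,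
      n∣m*n (1 * m)
    lift^ (suc v) m a p∤m D∣a
      with w , g≡ , p∤w ← geom-p a D∣a
      with u , p∤u , ∣u ← lift^ v m (a * geom (suc a) p) p∤m (∣m⇒∣m*n _ D∣a)
      = w * u , ∤-* p-prime p∤w p∤u , subst₂ _∣_ (sym geom≡) (eq p w (p ^ v) m u) (*-monoʳ-∣ (p * w) ∣u)
      where
      eq : ∀ p w z m u → p * w * (z * m * u) ≡ p * z * m * (w * u)
      eq = solve-∀
      geom≡ : geom (suc a) (p ^ suc v * m) ≡ p * w * geom (suc (a * geom (suc a) p)) (p ^ v * m)
      geom≡ = trans (cong (geom (suc a)) (*-assoc p (p ^ v) m))
        (trans (geom-* (suc a) p (p ^ v * m))
          (cong₂ (λ g x → g * geom x (p ^ v * m)) g≡ ([1+a]^k≡1+a*geom a p)))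

  -- A cofactor prime to `p` stands in for a valuation function: the content is v_p(geom) ≤ v_p(k).
  geom∣k*u : ∀ k a → 0 < k → D ∣ a → ∃ λ u → p ∤ u × geom (suc a) k ∣ k * u
  geom∣k*u k a k>0 D∣a with v , m , refl , p∤m ← p-part p-prime k k>0 = lift^ v m a p∤m D∣a

-- For `p = 2h + 1` the coefficient C(p, 2) is `h * p`, so with `p ∣ a` every term of the expansion
-- after the leading `p` is a multiple of `p ^ 2`.
geom-odd : ∀ h → Prime (suc (h + h)) → ∀ a → suc (h + h) ∣ a →
  ∃ λ w → geom (suc a) (suc (h + h)) ≡ suc (h + h) * w × suc (h + h) ∤ w
geom-odd h p-prime .(a′ * suc (h + h)) (divides-refl a′)
  with r , g≡ ← geom-expand (a′ * suc (h + h)) (suc (h + h)) =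
  suc (h + h) * (a′ * h + a′ * a′ * r) + 1 ,
  trans g≡ (trans (cong (λ t → p + a * t + a * a * r) (triangle-odd h)) (eq p h a′ r)) ,
  λ p∣w → prime∤1 p-prime (∣m+n∣m⇒∣n p∣w (m∣m*n (a′ * h + a′ * a′ * r)))
  where
  p = suc (h + h)
  a = a′ * p
  eq : ∀ p h a r → p + a * p * (h * p) + a * p * (a * p) * r ≡ p * (p * (a * h + a * a * r) + 1)
  eq = solve-∀

-- The sum is `2 + a`, twice an odd number when `4 ∣ a`. Evenness of `a` would not suffice: `a = 2`
-- gives 4.
geom-2 : ∀ a → 4 ∣ a → ∃ λ w → geom (suc a) 2 ≡ 2 * w × 2 ∤ w
geom-2 .(a′ * 4) (divides-refl a′) = 2 * a′ + 1 , eq a′ ,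
  λ 2∣w → prime∤1 prime[2] (∣m+n∣m⇒∣n 2∣w (m∣m*n a′))
  where
  eq : ∀ a → 1 + (1 + a * 4) * (1 + (1 + a * 4) * 0) ≡ 2 * (2 * a + 1)
  eq = solve-∀

-- Powers modulo an odd prime, up to sign.

-- Modulo `p = 2h + 1` the class of `r` is `s + 1` or its negative; `Fin h` counts from zero, hence
-- the `suc`. Its `h` elements serve as pigeonholes.
fold± : ∀ h r → 0 < r → r < suc (h + h) →
        ∃ λ (s : Fin h) → r ≡ suc (toℕ s) ⊎ r + suc (toℕ s) ≡ suc (h + h)
fold± h (suc r) _ (s≤s r<2h) with suc r ≤? h
... | yes r<h = fromℕ< r<h , inj₁ (cong suc (sym (toℕ-fromℕ< r<h)))
... | no  r≮h = fromℕ< t<h , inj₂ (trans (cong (λ t → suc r + suc t) (toℕ-fromℕ< t<h))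
                                  (trans (+-suc (suc r) t) (cong suc (m+[n∸m]≡n r<2h))))
  where
  t = h + h ∸ suc r
  t<h : t < h
  t<h = +-cancelʳ-< (suc r) t h (begin-strict
    t + suc r  ≡⟨ m∸n+n≡m r<2h ⟩
    h + h      <⟨ +-monoʳ-< h (≰⇒> r≮h) ⟩
    h + suc r  ∎)
    where open ≤-Reasoning

1<x⇒1<x^d : ∀ {x d} → 1 < x → 0 < d → 1 < x ^ d
1<x⇒1<x^d {x} {d} 1<x 0<d = ^-monoʳ-< x 1<x 0<d

module _ {h : ℕ} (p-prime : Prime (suc (h + h))) {x : ℕ} (1<x : 1 < x) (p∤x : suc (h + h) ∤ x) where

  private
    p = suc (h + h)
    instance
      x≢0 : NonZero x
      x≢0 = >-nonZero (<-trans z<s 1<x)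

    p∤x^ : ∀ i → p ∤ x ^ i
    p∤x^ i = p∤x ∘ prime∣^⇒∣ p-prime x i

    residue : ∀ i → ∃ λ (s : Fin h) → x ^ i % p ≡ suc (toℕ s) ⊎ x ^ i % p + suc (toℕ s) ≡ p
    residue i = fold± h (x ^ i % p) (n≢0⇒n>0 (p∤x^ i ∘ m%n≡0⇒n∣m (x ^ i) p)) (m%n<n (x ^ i) p)

    -- The difference `x ^ i * (x ^ d - 1)` is divisible by `p`, and `x ^ i` is not. The companion
    -- below treats the sum in the same way.
    %≡⇒∣ : ∀ i d → x ^ i % p ≡ x ^ (i + d) % p → p ∣ x ^ d ∸ 1
    %≡⇒∣ i d r≡ = [ (λ p∣xⁱ → contradiction p∣xⁱ (p∤x^ i)) , id ]′
      (euclidsLemma (x ^ i) (x ^ d ∸ 1) p-prime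
        (∣m+n∣m⇒∣n (subst (p ∣_) (+-cancelˡ-≡ (x ^ i % p) _ _ eq₁) (n∣m*n (x ^ (i + d) / p))) (n∣m*n (x ^ i / p))))
      where
      open ≡-Reasoning
      eq₂ : ∀ r q z a → (r + q) + z * a ≡ r + (q + z * a)
      eq₂ = solve-∀
      eq₁ : x ^ i % p + x ^ (i + d) / p * p ≡ x ^ i % p + (x ^ i / p * p + x ^ i * (x ^ d ∸ 1))
      eq₁ = begin
        x ^ i % p + x ^ (i + d) / p * p        ≡⟨ cong (_+ x ^ (i + d) / p * p) r≡ ⟩
        x ^ (i + d) % p + x ^ (i + d) / p * p  ≡⟨ m≡m%n+[m/n]*n (x ^ (i + d)) p ⟨
        x ^ (i + d)                            ≡⟨ ^-distribˡ-+-* x i d ⟩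
        x ^ i * x ^ d                          ≡⟨ cong (x ^ i *_) (m+[n∸m]≡n (m^n>0 x d)) ⟨
        x ^ i * (1 + (x ^ d ∸ 1))              ≡⟨ *-suc (x ^ i) (x ^ d ∸ 1) ⟩
        x ^ i + x ^ i * (x ^ d ∸ 1)            ≡⟨ cong (_+ x ^ i * (x ^ d ∸ 1)) (m≡m%n+[m/n]*n (x ^ i) p) ⟩
        (x ^ i % p + x ^ i / p * p) + x ^ i * (x ^ d ∸ 1) ≡⟨ eq₂ (x ^ i % p) _ (x ^ i) _ ⟩
        x ^ i % p + (x ^ i / p * p + x ^ i * (x ^ d ∸ 1)) ∎

    %+%≡p⇒∣ : ∀ i d → x ^ i % p + x ^ (i + d) % p ≡ p → p ∣ suc (x ^ d)
    %+%≡p⇒∣ i d r≡ = [ (λ p∣xⁱ → contradiction p∣xⁱ (p∤x^ i)) , id ]′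
      (euclidsLemma (x ^ i) (suc (x ^ d)) p-prime
        (subst (p ∣_) (sym eq₁) (∣m∣n⇒∣m+n ∣-refl (n∣m*n (x ^ i / p + x ^ (i + d) / p)))))
      where
      open ≡-Reasoning
      eq₂ : ∀ r q r′ q′ p → (r + q * p) + (r′ + q′ * p) ≡ (r + r′) + (q + q′) * p
      eq₂ = solve-∀
      eq₁ : x ^ i * suc (x ^ d) ≡ p + (x ^ i / p + x ^ (i + d) / p) * p
      eq₁ = begin
        x ^ i * suc (x ^ d)    ≡⟨ *-suc (x ^ i) (x ^ d) ⟩
        x ^ i + x ^ i * x ^ d  ≡⟨ cong (x ^ i +_) (^-distribˡ-+-* x i d) ⟨
        x ^ i + x ^ (i + d)    ≡⟨ cong₂ _+_ (m≡m%n+[m/n]*n (x ^ i) p) (m≡m%n+[m/n]*n (x ^ (i + d)) p) ⟩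
        (x ^ i % p + x ^ i / p * p) + (x ^ (i + d) % p + x ^ (i + d) / p * p)
          ≡⟨ eq₂ (x ^ i % p) (x ^ i / p) (x ^ (i + d) % p) (x ^ (i + d) / p) p ⟩
        (x ^ i % p + x ^ (i + d) % p) + (x ^ i / p + x ^ (i + d) / p) * p
          ≡⟨ cong (_+ (x ^ i / p + x ^ (i + d) / p) * p) r≡ ⟩
        p + (x ^ i / p + x ^ (i + d) / p) * p ∎

  -- The h + 1 powers x ^ 0, …, x ^ h fall into h nonzero classes modulo p up to sign.
  x^d≡±1 : ∃ λ d → 0 < d × d ≤ h × (p ∣ x ^ d ∸ 1 ⊎ p ∣ suc (x ^ d))
  x^d≡±1
    with i , j , i<j , fᵢ≡fⱼ ← pigeonhole (n<1+n h) (λ i → proj₁ (residue (toℕ i)))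
    = toℕ j ∸ toℕ i , m<n⇒0<n∸m i<j , ≤-trans (m∸n≤m (toℕ j) (toℕ i)) (s≤s⁻¹ (toℕ<n j)) , collide
    where
    d = toℕ j ∸ toℕ i
    i+d≡j : toℕ i + d ≡ toℕ j
    i+d≡j = m+[n∸m]≡n (<⇒≤ i<j)
    s = suc (toℕ (proj₁ (residue (toℕ j))))
    case-residue : ∀ {r r′} → r ≡ s ⊎ r + s ≡ p → r′ ≡ s ⊎ r′ + s ≡ p → r ≡ r′ ⊎ r + r′ ≡ p
    case-residue         (inj₁ r≡s)   (inj₁ r′≡s)   = inj₁ (trans r≡s (sym r′≡s))
    case-residue {r} {r′} (inj₁ refl) (inj₂ r′+s≡p) = inj₂ (trans (+-comm r r′) r′+s≡p)
    case-residue         (inj₂ r+s≡p) (inj₁ refl)   = inj₂ r+s≡p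
    case-residue {r} {r′} (inj₂ r+s≡p) (inj₂ r′+s≡p) = inj₁ (+-cancelʳ-≡ s r r′ (trans r+s≡p (sym r′+s≡p)))
    rᵢ = proj₂ (residue (toℕ i))
    rⱼ = proj₂ (residue (toℕ j))
    collide : p ∣ x ^ d ∸ 1 ⊎ p ∣ suc (x ^ d)
    collide with case-residue
      (subst (λ s → x ^ toℕ i % p ≡ suc (toℕ s) ⊎ x ^ toℕ i % p + suc (toℕ s) ≡ p) fᵢ≡fⱼ rᵢ)
      (subst (λ e → x ^ e % p ≡ s ⊎ x ^ e % p + s ≡ p) (sym i+d≡j) rⱼ)
    ... | inj₁ r≡  = inj₁ (%≡⇒∣ (toℕ i) d r≡)
    ... | inj₂ r+≡ = inj₂ (%+%≡p⇒∣ (toℕ i) d r+≡)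

  -- If `x ^ d` is 1 modulo `p`, then `c = x ^ d - 1` and `u = 1`. If it is -1, the exponent is
  -- doubled and `x ^ d + 1` alone carries the factor `p`. Either way `c` is of size `x ^ h` rather
  -- than `x ^ (p - 1)`, which the later estimate depends on.
  ∃-half-order : ∃ λ d → ∃₂ λ c u → 0 < d × d < p × 0 < c × c ≤ suc (x ^ h) × p ∤ u ×
                 x ^ d ≡ suc (c * u) × p ∣ c * u
  ∃-half-order with x^d≡±1
  ... | d , 0<d , d≤h , inj₁ p∣xᵈ-1 =
    d , x ^ d ∸ 1 , 1 , 0<d , s≤s (≤-trans d≤h (m≤m+n h h)) , m<n⇒0<n∸m (1<x⇒1<x^d 1<x 0<d) ,
    ≤-trans (m∸n≤m (x ^ d) 1) (m≤n⇒m≤1+n (^-monoʳ-≤ x d≤h)) , prime∤1 p-prime ,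
    sym (trans (cong suc (*-identityʳ _)) (m+[n∸m]≡n (m^n>0 x d))) , ∣m⇒∣m*n 1 p∣xᵈ-1
  ... | d , 0<d , d≤h , inj₂ p∣xᵈ+1 =
    d + d , suc (x ^ d) , x ^ d ∸ 1 , ≤-trans 0<d (m≤m+n d d) , s≤s (+-mono-≤ d≤h d≤h) , z<s ,
    s≤s (^-monoʳ-≤ x d≤h) , p∤xᵈ-1 , x²ᵈ , ∣m⇒∣m*n _ p∣xᵈ+1
    where
    xᵈ≡ : x ^ d ≡ 1 + (x ^ d ∸ 1)
    xᵈ≡ = sym (m+[n∸m]≡n (m^n>0 x d))
    p∤xᵈ-1 : p ∤ x ^ d ∸ 1
    -- Together with `p ∣ x ^ d + 1` this would give `p ∣ 2`, but `h ≥ d ≥ 1` makes `p ≥ 3`.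
    p∤xᵈ-1 p∣ = <⇒≱ (+-mono-≤ (≤-trans 0<d d≤h) (≤-trans 0<d d≤h)) (s≤s⁻¹ (∣⇒≤ {2} {p}
      (∣m+n∣m⇒∣n (subst (p ∣_) (trans (cong suc xᵈ≡) (+-comm 2 (x ^ d ∸ 1))) p∣xᵈ+1) p∣)))
    x²ᵈ : x ^ (d + d) ≡ suc (suc (x ^ d) * (x ^ d ∸ 1))
    x²ᵈ = trans (^-distribˡ-+-* x d d) (trans (cong (λ z → z * z) xᵈ≡)
      (trans (eq (x ^ d ∸ 1)) (cong (λ z → suc (suc z * (x ^ d ∸ 1))) (sym xᵈ≡))))
      where
      eq : ∀ a → (1 + a) * (1 + a) ≡ 1 + (2 + a) * a
      eq = solve-∀

-- Powers: divisibility and growth.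

^-distribʳ-* : ∀ m n o → (n * o) ^ m ≡ n ^ m * o ^ m
^-distribʳ-* zero    n o = refl
^-distribʳ-* (suc m) n o =
  trans (cong (n * o *_) (^-distribʳ-* m n o)) (eq n o (n ^ m) (o ^ m))
  where
  eq : ∀ n o y z → n * o * (y * z) ≡ n * y * (o * z)
  eq = solve-∀

^-monoˡ-∣ : ∀ n {x y} → x ∣ y → x ^ n ∣ y ^ n
^-monoˡ-∣ zero    x∣y = ∣-refl
^-monoˡ-∣ (suc n) x∣y = *-pres-∣ x∣y (^-monoˡ-∣ n x∣y)

∣⇒∣^ : ∀ {m x k} → 0 < k → m ∣ x → m ∣ x ^ k
∣⇒∣^ {x = x} {suc k} _ m∣x = ∣m⇒∣m*n (x ^ k) m∣x

-- The constant 3 is the value of 1 + i/n + (i/n)² at `i = n`.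
[1+n]^i≤3n^i : ∀ n i → 0 < n → i ≤ n → suc n ^ i ≤ 3 * n ^ i
[1+n]^i≤3n^i n i 0<n i≤n = *-cancelˡ-≤ (n * n) {{m*n≢0 n n}} (begin
  n * n * suc n ^ i              ≤⟨ go i i≤n ⟩
  n ^ i * (n * n + i * n + i * i)
    ≤⟨ *-monoʳ-≤ (n ^ i) (+-mono-≤ (+-monoʳ-≤ (n * n) (*-monoˡ-≤ n i≤n)) (*-mono-≤ i≤n i≤n)) ⟩
  n ^ i * (n * n + n * n + n * n) ≡⟨ eq n (n ^ i) ⟩
  n * n * (3 * n ^ i) ∎)
  where
  open ≤-Reasoning
  instance _ = >-nonZero 0<n
  eq : ∀ n z → z * (n * n + n * n + n * n) ≡ n * n * (3 * z)
  eq = solve-∀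
  -- (1 + 1/n)^i ≤ 1 + i/n + (i/n)² for i ≤ n, cleared of denominators.
  go : ∀ i → i ≤ n → n * n * suc n ^ i ≤ n ^ i * (n * n + i * n + i * i)
  go zero    _   = ≤-reflexive (eq₀ n)
    where
    eq₀ : ∀ n → n * n * 1 ≡ 1 * (n * n + 0 * n + 0 * 0)
    eq₀ = solve-∀
  go (suc i) i<n = begin
    n * n * (suc n * suc n ^ i)                     ≡⟨ eq₁ n (suc n ^ i) ⟩
    suc n * (n * n * suc n ^ i)                     ≤⟨ *-monoʳ-≤ (suc n) (go i (<⇒≤ i<n)) ⟩
    suc n * (n ^ i * (n * n + i * n + i * i))       ≡⟨ eq₂ n i (n ^ i) ⟩
    n ^ i * (X + i * i)
      ≤⟨ *-monoʳ-≤ (n ^ i) (+-monoʳ-≤ X (≤-trans (*-monoʳ-≤ i (<⇒≤ i<n)) (m≤m+n (i * n) n))) ⟩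
    n ^ i * (X + (i * n + n))                       ≡⟨ eq₃ n i (n ^ i) ⟩
    n * n ^ i * (n * n + suc i * n + suc i * suc i) ∎
    where
    X = n * n * n + i * n * n + i * i * n + n * n + i * n
    eq₁ : ∀ n z → n * n * ((1 + n) * z) ≡ (1 + n) * (n * n * z)
    eq₁ = solve-∀
    eq₂ : ∀ n i z → (1 + n) * (z * (n * n + i * n + i * i))
                  ≡ z * (n * n * n + i * n * n + i * i * n + n * n + i * n + i * i)
    eq₂ = solve-∀
    eq₃ : ∀ n i z → z * (n * n * n + i * n * n + i * i * n + n * n + i * n + (i * n + n))
                  ≡ n * z * (n * n + (1 + i) * n + (1 + i) * (1 + i))
    eq₃ = solve-∀

-- Induction on `n - p`: once `n > p`, raising `n` by one multiplies the left side by at most 3 and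
-- the right side by `p ≥ 3`. The exponent `1 + n` would be too small, as `p = 3`, `n = 4` shows.
n^[1+p]≤p^[2+n] : ∀ {p n} → 3 ≤ p → p ≤ n → n ^ suc p ≤ p ^ suc (suc n)
n^[1+p]≤p^[2+n] {p} 3≤p p≤n with d , refl ← m≤n⇒∃[o]m+o≡n p≤n = go d
  where
  open ≤-Reasoning
  0<p : 0 < p
  0<p = ≤-trans z<s 3≤p
  instance _ = >-nonZero 0<p
  go : ∀ d → (p + d) ^ suc p ≤ p ^ (2 + (p + d))
  go zero rewrite +-identityʳ p = ^-monoʳ-≤ p (n≤1+n (suc p))
  -- At base `p` the factor-3 estimate allows exponents up to `p` only, so one of the `p + 1`
  -- factors is split off and bounded by `p * p`.
  go (suc zero) rewrite +-comm p 1 = begin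
    suc p * suc p ^ p       ≤⟨ *-monoʳ-≤ (suc p) ([1+n]^i≤3n^i p p 0<p ≤-refl) ⟩
    suc p * (3 * p ^ p)     ≤⟨ *-mono-≤ 1+p≤p² (*-monoˡ-≤ (p ^ p) 3≤p) ⟩
    p * p * (p * p ^ p)     ≡⟨ *-assoc p p _ ⟩
    p * (p * (p * p ^ p))   ∎
    where
    1+p≤p² : suc p ≤ p * p
    1+p≤p² = ≤-trans (≤-trans (+-monoˡ-≤ p 0<p) (+-monoʳ-≤ p (m≤m+n p (p + 0)))) (*-monoˡ-≤ p 3≤p)
  go (suc (suc d)) = begin
    (p + suc (suc d)) ^ suc p  ≡⟨ cong (_^ suc p) (+-suc p (suc d)) ⟩
    suc (p + suc d) ^ suc p
      ≤⟨ [1+n]^i≤3n^i (p + suc d) (suc p) (≤-trans 0<p (m≤m+n p _)) (≤-trans (s≤s (m≤m+n p d)) (≤-reflexive (sym (+-suc p d)))) ⟩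
    3 * (p + suc d) ^ suc p    ≤⟨ *-mono-≤ 3≤p (go (suc d)) ⟩
    p * p ^ (2 + (p + suc d))  ≡⟨ cong (λ e → p ^ (2 + e)) (+-suc p (suc d)) ⟨
    p ^ (2 + (p + suc (suc d))) ∎

n³≤2^[2+n] : ∀ n → n * n * n ≤ 2 ^ (2 + n)
n³≤2^[2+n] 0 = z≤n
n³≤2^[2+n] 1 = m≤m+n 1 7
n³≤2^[2+n] 2 = m≤m+n 8 8
n³≤2^[2+n] 3 = m≤m+n 27 5
-- At 4 both sides are 64, and from 4 on an increase by one at most doubles the cube.
n³≤2^[2+n] (suc (suc (suc (suc n)))) = go n
  where
  open ≤-Reasoning
  go : ∀ n → (4 + n) * (4 + n) * (4 + n) ≤ 2 ^ (6 + n)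
  go zero    = ≤-refl
  go (suc n) = begin
    (5 + n) * (5 + n) * (5 + n)      ≤⟨ m≤m+n _ _ ⟩
    -- The added polynomial is 2(4 + n)³ - (5 + n)³; its coefficients are nonnegative.
    (5 + n) * (5 + n) * (5 + n) + (n * n * n + 9 * (n * n) + 21 * n + 3) ≡⟨ eq n ⟩
    2 * ((4 + n) * (4 + n) * (4 + n)) ≤⟨ *-monoʳ-≤ 2 (go n) ⟩
    2 ^ (7 + n)                       ∎
    where
    eq : ∀ n → (5 + n) * (5 + n) * (5 + n) + (n * n * n + 9 * (n * n) + 21 * n + 3)
             ≡ 2 * ((4 + n) * (4 + n) * (4 + n))
    eq = solve-∀

-- The gap between consecutive `q`-th powers.

-- In (m+1)^q - m^q = (m+1)^(q-1) + ... + m^(q-1), with q = n + 2, only the first and last terms are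
-- retained.
m^[2+n]+m^[1+n]+[1+m]^[1+n]≤[1+m]^[2+n] : ∀ m n →
  m ^ suc (suc n) + (m ^ suc n + suc m ^ suc n) ≤ suc m ^ suc (suc n)
m^[2+n]+m^[1+n]+[1+m]^[1+n]≤[1+m]^[2+n] m n = begin
  m * (m * m ^ n) + (m * m ^ n + suc m ^ suc n)  ≡⟨ eq m (m ^ n) (suc m ^ suc n) ⟩
  suc m ^ suc n + m * (suc m * m ^ n)
    ≤⟨ +-monoʳ-≤ (suc m ^ suc n) (*-monoʳ-≤ m (*-monoʳ-≤ (suc m) (^-monoˡ-≤ n (n≤1+n m)))) ⟩
  suc m ^ suc n + m * suc m ^ suc n              ∎
  where
  open ≤-Reasoning
  eq : ∀ m z y → m * (m * z) + (m * z + y) ≡ y + m * ((1 + m) * z)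
  eq = solve-∀

-- A solution has `y ≤ w = u * v - 1`. The gap from `w ^ q` to `(u * v) ^ q` is at least
-- `u ^ q + v ^ q`, whereas the product falls short of `(u * v) ^ q` by only `u ^ q + v ^ q - 1`.
[u^q-1][v^q-1]≢y^q : ∀ {u v} y n → 1 < u → u < v → v ≤ u ^ suc n →
  (u ^ suc (suc n) ∸ 1) * (v ^ suc (suc n) ∸ 1) ≢ y ^ suc (suc n)
[u^q-1][v^q-1]≢y^q {u} {v} y n 1<u u<v v≤ eq = <-irrefl refl (begin-strict
  y ^ q + (u ^ q + v ^ q)          ≤⟨ +-mono-≤ (^-monoˡ-≤ q y≤w) (+-mono-≤ u^q≤w^[q-1] v^q≤[uv]^[q-1]) ⟩
  w ^ q + (w ^ suc n + suc w ^ suc n) ≤⟨ m^[2+n]+m^[1+n]+[1+m]^[1+n]≤[1+m]^[2+n] w n ⟩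
  suc w ^ q                        ≡⟨ cong (_^ q) uv≡1+w ⟨
  (u * v) ^ q                      <⟨ n<1+n _ ⟩
  suc ((u * v) ^ q)                ≡⟨ cong suc [uv]^q≡ ⟩
  suc (suc A * suc B)              ≡⟨ eq₁ A B ⟩
  A * B + (suc A + suc B)          ≡⟨ cong₂ _+_ eq (cong₂ _+_ (sym u^q≡) (sym v^q≡)) ⟩
  y ^ q + (u ^ q + v ^ q)          ∎)
  where
  open ≤-Reasoning
  q = suc (suc n)
  A = u ^ q ∸ 1
  B = v ^ q ∸ 1
  w = u * v ∸ 1
  instance
    u≢0 : NonZero u
    u≢0 = >-nonZero (<-trans z<s 1<u)
    v≢0 : NonZero v
    v≢0 = >-nonZero (<-trans z<s (<-trans 1<u u<v))
  u^q≡ : u ^ q ≡ suc A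
  u^q≡ = sym (m+[n∸m]≡n (m^n>0 u q))
  v^q≡ : v ^ q ≡ suc B
  v^q≡ = sym (m+[n∸m]≡n (m^n>0 v q))
  [uv]^q≡ : (u * v) ^ q ≡ suc A * suc B
  [uv]^q≡ = trans (^-distribʳ-* q u v) (cong₂ _*_ u^q≡ v^q≡)
  uv≡1+w : u * v ≡ suc w
  uv≡1+w = sym (m+[n∸m]≡n (>-nonZero⁻¹ (u * v) {{m*n≢0 u v}}))
  eq₁ : ∀ A B → 1 + (1 + A) * (1 + B) ≡ A * B + ((1 + A) + (1 + B))
  eq₁ = solve-∀
  y≤w : y ≤ w
  y≤w = s≤s⁻¹ (subst (y <_) uv≡1+w (≰⇒> λ uv≤y → <-irrefl refl (begin-strict
    A * B          <⟨ m≤m+n (suc (A * B)) (A + B) ⟩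
    suc (A * B) + (A + B) ≡⟨ eq₂ A B ⟩
    suc A * suc B  ≡⟨ [uv]^q≡ ⟨
    (u * v) ^ q    ≤⟨ ^-monoˡ-≤ q uv≤y ⟩
    y ^ q          ≡⟨ eq ⟨
    A * B          ∎)))
    where
    eq₂ : ∀ A B → 1 + A * B + (A + B) ≡ (1 + A) * (1 + B)
    eq₂ = solve-∀
  u²≤w : u * u ≤ w
  u²≤w = s≤s⁻¹ (begin
    suc (u * u)  ≤⟨ +-monoˡ-≤ (u * u) (<⇒≤ 1<u) ⟩
    u + u * u    ≡⟨ *-suc u u ⟨
    u * suc u    ≤⟨ *-monoʳ-≤ u u<v ⟩
    u * v        ≡⟨ uv≡1+w ⟩
    suc w        ∎)
  u^q≤w^[q-1] : u ^ q ≤ w ^ suc n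
  u^q≤w^[q-1] = begin
    -- Since `q ≥ 2`, the exponent `q` is at most `2 * (q - 1)`.
    u * u ^ suc n          ≤⟨ *-monoˡ-≤ (u ^ suc n) (m≤m*n u (u ^ n) {{m^n≢0 u n}}) ⟩
    u ^ suc n * u ^ suc n  ≡⟨ ^-distribʳ-* (suc n) u u ⟨
    (u * u) ^ suc n        ≤⟨ ^-monoˡ-≤ (suc n) u²≤w ⟩
    w ^ suc n              ∎
  v^q≤[uv]^[q-1] : v ^ q ≤ suc w ^ suc n
  v^q≤[uv]^[q-1] = begin
    v * v ^ suc n          ≤⟨ *-monoˡ-≤ (v ^ suc n) v≤ ⟩
    u ^ suc n * v ^ suc n  ≡⟨ ^-distribʳ-* (suc n) u v ⟨
    (u * v) ^ suc n        ≡⟨ cong (_^ suc n) uv≡1+w ⟩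
    suc w ^ suc n          ∎

-- Parity.

even⊎odd : ∀ n → ∃ λ s → n ≡ s + s ⊎ n ≡ suc (s + s)
even⊎odd zero = 0 , inj₁ refl
even⊎odd (suc n) with even⊎odd n
... | s , inj₁ refl = s , inj₂ refl
... | s , inj₂ refl = suc s , inj₁ (cong suc (sym (+-suc s s)))

parity-s+s : ∀ s → parity (s + s) ≡ 0ℙ
parity-s+s zero    = refl
parity-s+s (suc s) rewrite +-suc s s = parity-s+s s

parity≡1⇒odd : ∀ n → parity n ≡ 1ℙ → ∃ λ s → n ≡ suc (s + s)
parity≡1⇒odd n n-odd with even⊎odd n
... | s , inj₂ n≡   = s , n≡
... | s , inj₁ refl = contradiction (trans (sym (parity-s+s s)) n-odd) λ ()

2∣s+s : ∀ s → 2 ∣ s + s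
2∣s+s s = divides s (sym (trans (*-comm s 2) (cong (s +_) (+-identityʳ s))))

2∤1+s+s : ∀ s → 2 ∤ suc (s + s)
2∤1+s+s s 2∣ = prime∤1 prime[2] (∣m+n∣m⇒∣n (subst (2 ∣_) (+-comm 1 (s + s)) 2∣) (2∣s+s s))

odd-prime : ∀ {p} → Prime p → p ≢ 2 → ∃ λ h → p ≡ suc (h + h)
odd-prime {p} p-prime p≢2 with even⊎odd p
... | h , inj₂ p≡ = h , p≡
... | h , inj₁ refl with prime⇒irreducible p-prime (2∣s+s h)
...   | inj₂ 2≡p = contradiction (sym 2≡p) p≢2

-- Bounds for the `p`-part of `x ^ k - 1`.

-- The exponent `d` from `∃-half-order` is below `p`, so it divides `k`, and lifting the exponent
-- applies to `(x ^ d) ^ (k / d)`. If `p ∣ x`, then `x ^ k - 1` is prime to `p` and goes entirely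
-- into `u`.
x^k-1∣c*k*u : ∀ {h} → Prime (suc (h + h)) → ∀ {x k} → 1 < x → 0 < k →
  (∀ n → 0 < n → n < suc (h + h) → n ∣ k) →
  ∃₂ λ c u → 0 < c × c ≤ suc (x ^ h) × suc (h + h) ∤ u × x ^ k ∸ 1 ∣ c * k * u ×
             (suc (h + h) ∤ x → suc (h + h) ∣ x ^ k ∸ 1)
x^k-1∣c*k*u {h} p-prime {x} {k} 1<x 0<k small∣k with suc (h + h) ∣? x
... | yes p∣x = 1 , x ^ k ∸ 1 , z<s , s≤s z≤n , p∤xᵏ-1 , n∣m*n (1 * k) , λ p∤x → contradiction p∣x p∤x
  where
  instance _ = >-nonZero (<-trans z<s 1<x)
  p∤xᵏ-1 : suc (h + h) ∤ x ^ k ∸ 1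
  p∤xᵏ-1 p∣ = prime∤1 p-prime (∣m+n∣m⇒∣n
    (subst (suc (h + h) ∣_) (sym (m∸n+n≡m (m^n>0 x k))) (∣⇒∣^ 0<k p∣x)) p∣)
... | no p∤x
  with d , c , u , 0<d , d<p , 0<c , c≤ , p∤u , xᵈ≡ , p∣cu ← ∃-half-order {h} p-prime 1<x p∤x
  with divides k′ refl ← small∣k d 0<d d<p
  with u′ , p∤u′ , geom∣ ← geom∣k*u p-prime ∣-refl (geom-odd h p-prime) k′ (c * u)
         (n≢0⇒n>0 λ { refl → <-irrefl refl 0<k }) p∣cu
  = c , u * u′ , 0<c , c≤ , ∤-* p-prime p∤u p∤u′ ,
    subst₂ _∣_ (sym xᵏ-1≡) (eq c u k′ d u′) (∣m⇒∣m*n d (*-monoʳ-∣ (c * u) geom∣)) ,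
    λ _ → subst (suc (h + h) ∣_) (sym xᵏ-1≡) (∣m⇒∣m*n _ p∣cu)
  where
  xᵏ-1≡ : x ^ (k′ * d) ∸ 1 ≡ c * u * geom (suc (c * u)) k′
  xᵏ-1≡ = cong (_∸ 1) (trans (cong (x ^_) (*-comm k′ d)) (trans (sym (^-*-assoc x d k′))
    (trans (cong (_^ k′) xᵈ≡) ([1+a]^k≡1+a*geom (c * u) k′))))
  eq : ∀ c u k d w → c * u * (k * w) * d ≡ c * (k * d) * (u * w)
  eq = solve-∀

-- With `b = 2s + 1`, `b * b - 1 = 4 * s * (s + 1)`. The odd one of `s`, `s + 1` becomes the last
-- factor, and `c` is twice the even one, hence at most `b + 1`.
odd²-1 : ∀ s → 0 < s → ∃₂ λ c t → 0 < c × c ≤ suc (suc (s + s)) × 4 ∣ c ×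
  suc (s + s) * suc (s + s) ≡ suc (2 * c * suc (t + t))
odd²-1 s 0<s with even⊎odd s
... | t , inj₁ refl = t * 4 , t , ≤-trans (m≤m+n 1 3) (*-monoˡ-≤ 4 {1} {t} (n≢0⇒n>0 λ { refl → <-irrefl refl 0<s })) ,
  ≤-trans (≤-reflexive (eq₁ t)) (m≤n+m _ 2) , n∣m*n t , eq₂ t
  where
  eq₁ : ∀ t → t * 4 ≡ t + t + (t + t)
  eq₁ = solve-∀
  eq₂ : ∀ t → suc (t + t + (t + t)) * suc (t + t + (t + t)) ≡ suc (2 * (t * 4) * suc (t + t))
  eq₂ = solve-∀
... | t , inj₂ refl = suc t * 4 , t , z<s , ≤-reflexive (eq₁ t) , n∣m*n (suc t) , eq₂ t
  where
  eq₁ : ∀ t → (1 + t) * 4 ≡ 2 + (1 + (t + t) + (1 + (t + t)))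
  eq₁ = solve-∀
  eq₂ : ∀ t → (1 + (1 + (t + t) + (1 + (t + t)))) * (1 + (1 + (t + t) + (1 + (t + t))))
            ≡ 1 + (2 * ((1 + t) * 4) * (1 + (t + t)))
  eq₂ = solve-∀

-- As `b - 1` need not be a multiple of 4, the exponent is lifted for `b * b`; `b ^ k - 1` divides
-- `b ^ (2 * k) - 1`.
odd^k-1∣2c*k*u : ∀ s {k} → 0 < s → 0 < k →
  ∃₂ λ c u → 0 < c × c ≤ suc (suc (s + s)) × 2 ∤ u × suc (s + s) ^ k ∸ 1 ∣ 2 * c * k * u
odd^k-1∣2c*k*u s {k} 0<s 0<k
  with c , t , 0<c , c≤ , 4∣c , b²≡ ← odd²-1 s 0<s
  with u′ , 2∤u′ , geom∣ ← geom∣k*u prime[2] (divides 2 refl) geom-2 k (2 * c * suc (t + t)) 0<k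
         (∣m⇒∣m*n (suc (t + t)) (∣n⇒∣m*n 2 4∣c))
  = c , suc (t + t) * u′ , 0<c , c≤ , ∤-* prime[2] (2∤1+s+s t) 2∤u′ ,
    ∣-trans (subst (g ∣_) (suc-injective g[2+g]≡) (m∣m*n (2 + g)))
      (subst (a * geom (suc a) k ∣_) (eq₂ c (suc (t + t)) k u′) (*-monoʳ-∣ a geom∣))
  where
  open ≡-Reasoning
  b = suc (s + s)
  g = b ^ k ∸ 1
  a = 2 * c * suc (t + t)
  eq₁ : ∀ g → 1 + g * (2 + g) ≡ (1 + g) * (1 + g)
  eq₁ = solve-∀
  eq₂ : ∀ c v k u → 2 * c * v * (k * u) ≡ 2 * c * k * (v * u)
  eq₂ = solve-∀
  g[2+g]≡ : suc (g * (2 + g)) ≡ suc (a * geom (suc a) k)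
  g[2+g]≡ = begin
    suc (g * (2 + g))         ≡⟨ eq₁ g ⟩
    suc g * suc g             ≡⟨ cong (λ z → z * z) (m+[n∸m]≡n (m^n>0 b k)) ⟩
    b ^ k * b ^ k             ≡⟨ ^-distribʳ-* k b b ⟨
    (b * b) ^ k               ≡⟨ cong (_^ k) b²≡ ⟩
    suc a ^ k                 ≡⟨ [1+a]^k≡1+a*geom a k ⟩
    suc (a * geom (suc a) k)  ∎

-- Size estimates that force prime powers into `k`.

-- Let `p ^ v` be the `p`-part of `k`. If `v < e`, then `p ^ (v + 1) ≤ q`, and
-- `p ^ q ≤ C * (p ^ v) ^ j` multiplied by `p ^ j` contradicts the strict bound.
p^q∣C*k^j⇒p^e∣k : ∀ {p} → Prime p → ∀ {q C k} j e → 0 < C → 0 < k →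
  p ^ q ∣ C * k ^ j → C * q ^ j < p ^ (q + j) → p ^ e ≤ q → p ^ e ∣ k
p^q∣C*k^j⇒p^e∣k {p} p-prime {q} {C} {k} j e 0<C 0<k p^q∣ C*q^j< p^e≤q
  with v , m , refl , p∤m ← p-part p-prime k 0<k
  with e ≤? v
... | yes e≤v = ∣m⇒∣m*n m (subst (p ^ e ∣_) (trans (sym (^-distribˡ-+-* p e (v ∸ e))) (cong (p ^_) (m+[n∸m]≡n e≤v))) (m∣m*n _))
... | no e≰v = contradiction C*q^j< (≤⇒≯ (begin
    p ^ (q + j)               ≡⟨ ^-distribˡ-+-* p q j ⟩
    p ^ q * p ^ j             ≤⟨ *-monoˡ-≤ (p ^ j) (∣⇒≤ p^q∣C*) ⟩
    C * (p ^ v) ^ j * p ^ j   ≡⟨ eq₂ C ((p ^ v) ^ j) (p ^ j) ⟩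
    C * (p ^ j * (p ^ v) ^ j) ≡⟨ cong (C *_) (^-distribʳ-* j p (p ^ v)) ⟨
    C * (p ^ suc v) ^ j       ≤⟨ *-monoʳ-≤ C (^-monoˡ-≤ j (≤-trans (^-monoʳ-≤ p (≰⇒> e≰v)) p^e≤q)) ⟩
    C * q ^ j                 ∎))
  where
  open ≤-Reasoning
  instance
    _ = prime⇒nonZero p-prime
    C≢0 : NonZero C
    C≢0 = >-nonZero 0<C
    C*≢0 : NonZero (C * (p ^ v) ^ j)
    C*≢0 = m*n≢0 C ((p ^ v) ^ j) {{C≢0}} {{m^n≢0 (p ^ v) j {{m^n≢0 p v}}}}
  eq₁ : ∀ C y z → C * (y * z) ≡ z * (C * y)
  eq₁ = solve-∀
  eq₂ : ∀ C y z → C * y * z ≡ C * (z * y)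
  eq₂ = solve-∀
  p^q∣C* : p ^ q ∣ C * (p ^ v) ^ j
  p^q∣C* = prime^∣-cancel p-prime q (p∤m ∘ prime∣^⇒∣ p-prime m j)
    (subst (p ^ q ∣_) (trans (cong (C *_) (^-distribʳ-* j (p ^ v) m)) (eq₁ C ((p ^ v) ^ j) (m ^ j))) p^q∣)

1+n≤2*n : ∀ {n} → 0 < n → suc n ≤ 2 * n
1+n≤2*n {n} 0<n = +-mono-≤ 0<n (m≤m+n n 0)

odd-bound : ∀ {h b q c₁ c₂} → 0 < h → 0 < b → 2 ·√ (2 * b) < q → suc (h + h) ≤ q →
  c₁ ≤ suc (2 ^ h) → c₂ ≤ suc (b ^ h) → c₁ * c₂ * q ^ 2 < suc (h + h) ^ (q + 2)
odd-bound {h} {b} {q} {c₁} {c₂} 0<h 0<b 8b<q² p≤q c₁≤ c₂≤ = begin-strict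
  c₁ * c₂ * q ^ 2           <⟨ *-monoˡ-< (q ^ 2) {{m^n≢0 q 2}} c₁c₂<q²ʰ ⟩
  (q * q) ^ h * q ^ 2       ≡⟨ cong (_* q ^ 2) (^-distribʳ-* h q q) ⟩
  q ^ h * q ^ h * q ^ 2     ≡⟨ cong (_* q ^ 2) (^-distribˡ-+-* q h h) ⟨
  q ^ (h + h) * q ^ 2       ≡⟨ ^-distribˡ-+-* q (h + h) 2 ⟨
  q ^ (h + h + 2)           ≡⟨ cong (q ^_) (+-comm (h + h) 2) ⟩
  q ^ suc (suc (h + h))     ≤⟨ n^[1+p]≤p^[2+n] (s≤s (+-mono-≤ 0<h 0<h)) p≤q ⟩
  suc (h + h) ^ (2 + q)     ≡⟨ cong (suc (h + h) ^_) (+-comm 2 q) ⟩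
  suc (h + h) ^ (q + 2)     ∎
  where
  open ≤-Reasoning
  instance
    h≢0 : NonZero h
    h≢0 = >-nonZero 0<h
    b≢0 : NonZero b
    b≢0 = >-nonZero 0<b
    q≢0 : NonZero q
    q≢0 = >-nonZero (≤-trans z<s p≤q)
  eq : ∀ z x y → z * (2 * x * (2 * y)) ≡ 4 * (z * (x * y))
  eq = solve-∀
  c₁c₂<q²ʰ : c₁ * c₂ < (q * q) ^ h
  c₁c₂<q²ʰ = *-cancelˡ-< (4 ^ h) _ _ (begin-strict
    -- The factor `4 ^ h` turns `(2 * b) ^ h` into `(8 * b) ^ h`, which the hypothesis compares with
    -- `(q * q) ^ h`; the spare 4 is absorbed because `h ≥ 1`.
    4 ^ h * (c₁ * c₂)
      ≤⟨ *-monoʳ-≤ (4 ^ h) (*-mono-≤ (≤-trans c₁≤ (1+n≤2*n (m^n>0 2 h))) (≤-trans c₂≤ (1+n≤2*n (m^n>0 b h)))) ⟩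
    4 ^ h * (2 * 2 ^ h * (2 * b ^ h))
      ≡⟨ eq (4 ^ h) (2 ^ h) (b ^ h) ⟩
    4 * (4 ^ h * (2 ^ h * b ^ h))
      ≡⟨ cong (λ z → 4 * (4 ^ h * z)) (^-distribʳ-* h 2 b) ⟨
    4 * (4 ^ h * (2 * b) ^ h)
      ≡⟨ cong (4 *_) (^-distribʳ-* h 4 (2 * b)) ⟨
    4 * (4 * (2 * b)) ^ h
      <⟨ *-monoʳ-< 4 (^-monoˡ-< h 8b<q²) ⟩
    4 * (q * q) ^ h
      ≤⟨ *-monoˡ-≤ ((q * q) ^ h) (^-monoʳ-≤ 4 0<h) ⟩
    4 ^ h * (q * q) ^ h ∎)

2-bound : ∀ {b q c} → 0 < b → 0 < q → 2 ·√ (2 * b) < q → c ≤ suc b → 2 * c * q ^ 1 < 2 ^ (q + 1)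
2-bound {b} {q} {c} 0<b 0<q 8b<q² c≤ = *-cancelˡ-< 2 _ _ (begin-strict
  2 * (2 * c * q ^ 1)        ≡⟨ eq c q ⟩
  4 * c * q                  ≤⟨ *-monoˡ-≤ q (*-monoʳ-≤ 4 (≤-trans c≤ (1+n≤2*n 0<b))) ⟩
  4 * (2 * b) * q            <⟨ *-monoˡ-< q 8b<q² ⟩
  q * q * q                  ≤⟨ n³≤2^[2+n] q ⟩
  2 ^ (2 + q)                ≡⟨ cong (λ e → 2 * 2 ^ e) (+-comm 1 q) ⟩
  2 * 2 ^ (q + 1)            ∎)
  where
  open ≤-Reasoning
  instance _ = >-nonZero 0<q
  eq : ∀ c q → 2 * (2 * c * (q * 1)) ≡ 4 * c * q
  eq = solve-∀

-- Raised to the power `t`, this supplies the condition `v ≤ u ^ (q - 1)` for `u = 2 ^ t`,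
-- `v = b ^ t`.
b≤2^ : ∀ {b} n → 2 ·√ (2 * b) < suc (suc n) → b ≤ 2 ^ suc n
b≤2^ {b} n 8b<q² = *-cancelˡ-≤ 16 (begin
  16 * b                       ≡⟨ eq b ⟩
  2 * (4 * (2 * b))            ≤⟨ *-mono-≤ {2} {q} (s≤s (s≤s z≤n)) (<⇒≤ 8b<q²) ⟩
  q * (q * q)                  ≡⟨ *-assoc q q q ⟨
  q * q * q                    ≤⟨ n³≤2^[2+n] q ⟩
  2 ^ (2 + q)                  ≡⟨ eq′ (2 ^ suc n) ⟩
  8 * 2 ^ suc n                ≤⟨ *-monoˡ-≤ (2 ^ suc n) (m≤m+n 8 8) ⟩
  16 * 2 ^ suc n               ∎)
  where
  open ≤-Reasoning
  q = suc (suc n)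
  eq : ∀ b → 16 * b ≡ 2 * (4 * (2 * b))
  eq = solve-∀
  eq′ : ∀ z → 2 * (2 * (2 * z)) ≡ 8 * z
  eq′ = solve-∀

-- Every positive `n ≤ q` divides the exponent `k` of a solution.

module _ {s q k y : ℕ} (0<s : 0 < s) (8b<q² : 2 ·√ (2 * suc (s + s)) < q) (0<k : 0 < k)
         (eq : (2 ^ k ∸ 1) * (suc (s + s) ^ k ∸ 1) ≡ y ^ q) where

  private
    b = suc (s + s)

    1<b : 1 < b
    1<b = s≤s (≤-trans 0<s (m≤m+n s s))

    0<b : 0 < b
    0<b = z<s

    p^q∣ : ∀ {p} → Prime p → p ∣ (2 ^ k ∸ 1) * (b ^ k ∸ 1) → p ^ q ∣ (2 ^ k ∸ 1) * (b ^ k ∸ 1)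
    p^q∣ {p} p-prime p∣ = subst (p ^ q ∣_) (sym eq)
      (^-monoˡ-∣ q (prime∣^⇒∣ p-prime y q (subst (p ∣_) eq p∣)))

    2∣b^k-1 : 2 ∣ b ^ k ∸ 1
    2∣b^k-1 = subst (2 ∣_) (sym (cong (_∸ 1) ([1+a]^k≡1+a*geom (s + s) k))) (∣m⇒∣m*n _ (2∣s+s s))

    2∤2^k-1 : 2 ∤ 2 ^ k ∸ 1
    2∤2^k-1 2∣ = prime∤1 prime[2] (∣m+n∣m⇒∣n
      (subst (2 ∣_) (sym (m∸n+n≡m (m^n>0 2 k))) (∣⇒∣^ 0<k ∣-refl)) 2∣)

    -- Since `2 ^ k - 1` is odd, all of `2 ^ q` divides `b ^ k - 1`; so `k` enters only to the first
    -- power.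
    2^e∣k : ∀ e → 2 ^ e ≤ q → 2 ^ e ∣ k
    2^e∣k e 2^e≤q with c , u , 0<c , c≤ , 2∤u , ∣cku ← odd^k-1∣2c*k*u s 0<s 0<k =
      p^q∣C*k^j⇒p^e∣k prime[2] {q} 1 e (≤-trans 0<c (m≤m+n c _)) 0<k
        (prime^∣-cancel prime[2] q 2∤u (subst (2 ^ q ∣_) (eq₁ c k u) (∣-trans
          (prime^∣-cancel prime[2] q 2∤2^k-1 (p^q∣ prime[2] (∣n⇒∣m*n (2 ^ k ∸ 1) 2∣b^k-1)))
          ∣cku)))
        (2-bound 0<b (≤-trans (m^n>0 2 e) 2^e≤q) 8b<q² c≤) 2^e≤q
      where
      eq₁ : ∀ c k u → 2 * c * k * u ≡ u * (2 * c * (k * 1))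
      eq₁ = solve-∀

    -- As `p` is odd, it divides `2 ^ k - 1` and hence `y`. Both factors can contribute to `p ^ q`,
    -- so `k` enters squared.
    odd^e∣k : ∀ h e → Prime (suc (h + h)) → (∀ n → 0 < n → n < suc (h + h) → n ∣ k) →
              suc (h + h) ≤ q → suc (h + h) ^ e ≤ q → suc (h + h) ^ e ∣ k
    odd^e∣k zero       e p-prime _       _   _     = contradiction p-prime ¬prime[1]
    odd^e∣k h@(suc h′) e p-prime small∣k p≤q p^e≤q
      with c₁ , u₁ , 0<c₁ , c₁≤ , p∤u₁ , ∣cku₁ , p∣₁ ← x^k-1∣c*k*u {h} p-prime {2} (s≤s z<s) 0<k small∣k
      with c₂ , u₂ , 0<c₂ , c₂≤ , p∤u₂ , ∣cku₂ , _   ← x^k-1∣c*k*u {h} p-prime 1<b 0<k small∣k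
      = p^q∣C*k^j⇒p^e∣k p-prime {q} 2 e (*-mono-≤ 0<c₁ 0<c₂) 0<k
          (prime^∣-cancel p-prime q (∤-* p-prime p∤u₁ p∤u₂)
            (subst (suc (h + h) ^ q ∣_) (eq₁ c₁ k u₁ c₂ u₂)
              (∣-trans (p^q∣ p-prime (∣m⇒∣m*n _ (p∣₁ p∤2))) (*-pres-∣ ∣cku₁ ∣cku₂))))
          (odd-bound {h} z<s 0<b 8b<q² p≤q c₁≤ c₂≤) p^e≤q
      where
      eq₁ : ∀ c k u d v → c * k * u * (d * k * v) ≡ u * v * (c * d * (k * (k * 1)))
      eq₁ = solve-∀
      p∤2 : suc (h + h) ∤ 2
      p∤2 p∣2 = contradiction (s≤s⁻¹ (∣⇒≤ p∣2)) (<⇒≱ (+-mono-≤ {1} {h} {1} {h} z<s z<s))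

  n∣k : ∀ n → 0 < n → n ≤ q → n ∣ k
  n∣k = <-rec _ go
    where
    go : ∀ n → (∀ {m} → m < n → 0 < m → m ≤ q → m ∣ k) → 0 < n → n ≤ q → n ∣ k
    go 1 _ _ _ = 1∣ k
    go n@(2+ _) rec 0<n n≤q
      with p , p-prime , p∣n ← ∃prime∣ n (s≤s z<s)
      with p-part p-prime n 0<n
    ... | zero , m , n≡ , p∤m = contradiction (subst (p ∣_) (trans n≡ (*-identityˡ m)) p∣n) p∤m
    ... | e@(suc e′) , 0 , n≡ , _ = contradiction (trans n≡ (*-zeroʳ (p ^ e))) λ ()
    ... | e@(suc e′) , 1 , n≡ , _ = subst (_∣ k) (sym n≡p^e) p^e∣k
      where
      n≡p^e : n ≡ p ^ e
      n≡p^e = trans n≡ (*-identityʳ (p ^ e))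
      p^e≤q : p ^ e ≤ q
      p^e≤q = subst (_≤ q) n≡p^e n≤q
      p≤n : p ≤ n
      p≤n = ∣⇒≤ p∣n
      p^e∣k : p ^ e ∣ k
      p^e∣k with p ≟ 2
      ... | yes refl = 2^e∣k e p^e≤q
      ... | no p≢2 with h , refl ← odd-prime p-prime p≢2 =
        odd^e∣k h e p-prime (λ m 0<m m<p → rec (<-≤-trans m<p p≤n) 0<m (<⇒≤ (<-≤-trans m<p (≤-trans p≤n n≤q))))
          (≤-trans p≤n n≤q) p^e≤q
    -- Both `p ^ e` and `m` are smaller than `n` and coprime, so the induction hypothesis for each
    -- gives their product.
    ... | e@(suc e′) , m@(2+ _) , n≡ , p∤m = subst (_∣ k) (sym n≡) p^e*m∣k
      where
      instance
        _ = prime⇒nonZero p-prime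
        _ = m^n≢0 p e
      1<p^e : 1 < p ^ e
      1<p^e = 1<x⇒1<x^d {d = e} (nonTrivial⇒n>1 p {{prime⇒nonTrivial p-prime}}) z<s
      p^e<n : p ^ e < n
      p^e<n = subst (p ^ e <_) (sym n≡) (m<m*n (p ^ e) m (s≤s z<s))
      m<n : m < n
      m<n = subst (m <_) (trans (*-comm m (p ^ e)) (sym n≡)) (m<m*n m (p ^ e) 1<p^e)
      p^e*m∣k : p ^ e * m ∣ k
      p^e*m∣k with divides t refl ← rec p^e<n (m^n>0 p e) (<⇒≤ (<-≤-trans p^e<n n≤q)) =
        subst (p ^ e * m ∣_) (*-comm (p ^ e) t) (*-monoʳ-∣ (p ^ e)
          (coprime-divisor (coprime-prime^ p-prime p∤m e)
            (subst (m ∣_) (*-comm t (p ^ e)) (rec m<n z<s (<⇒≤ (<-≤-trans m<n n≤q))))))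

-- The contradiction from `k = t * q`.

theorem2 : ∀ (b q : ℕ) → 0 < b → parity b ≡ 1ℙ → Prime q → parity q ≡ 1ℙ →
    2 ·√ (2 * b) < q →
    ¬ (∃₂ λ (k y : ℕ) → 0 < k × 0 < y × (2 ^ k ∸ 1) * (b ^ k ∸ 1) ≡ y ^ q)
theorem2 b 0 _ _ _ _ () _
theorem2 b 1 _ _ q-prime _ _ _ = contradiction q-prime ¬prime[1]
theorem2 b q@(2+ n) _ b-odd _ _ 8b<q² (k , y , 0<k , 0<y , eq) with parity≡1⇒odd b b-odd
-- For `b = 1` the product is 0, while `y ^ q` is positive.
... | zero , refl = <⇒≢ (m^n>0 y {{>-nonZero 0<y}} q) (trans (sym (trans
        (cong (λ z → (2 ^ k ∸ 1) * (z ∸ 1)) (^-zeroˡ k)) (*-zeroʳ (2 ^ k ∸ 1)))) eq)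
... | s@(suc s′) , refl with n∣k {s} {q} {k} {y} z<s 8b<q² 0<k eq q z<s ≤-refl
...   | divides t refl = [u^q-1][v^q-1]≢y^q {2 ^ t} {b ^ t} y n (1<x⇒1<x^d {2} (s≤s z<s) 0<t)
          (^-monoˡ-< t {{>-nonZero 0<t}} 2<b) b^t≤
          (trans (cong₂ (λ z w → (z ∸ 1) * (w ∸ 1)) (^-*-assoc 2 t q) (^-*-assoc b t q)) eq)
  where
  open ≤-Reasoning
  0<t : 0 < t
  0<t = n≢0⇒n>0 λ { refl → <-irrefl refl 0<k }
  2<b : 2 < b
  2<b = s≤s (+-mono-≤ {1} {s} {1} {s} z<s z<s)
  b^t≤ : b ^ t ≤ (2 ^ t) ^ suc n
  b^t≤ = begin
    b ^ t            ≤⟨ ^-monoˡ-≤ t (b≤2^ n 8b<q²) ⟩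
    (2 ^ suc n) ^ t  ≡⟨ ^-*-assoc 2 (suc n) t ⟩
    2 ^ (suc n * t)  ≡⟨ cong (2 ^_) (*-comm (suc n) t) ⟩
    2 ^ (t * suc n)  ≡⟨ ^-*-assoc 2 t (suc n) ⟨
    (2 ^ t) ^ suc n  ∎
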